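{- For all integers $n,m\geq 4$, $s_6(P_n\square P_m)=4$.
   Context: $P_k$ denotes the path on $k$ vertices, and $\square$ denotes the Cartesian product of graphs. A $P_k$-coloring of a graph $G$ is a proper vertex coloring of $G$ in which no copy of $P_k$ in $G$ (as a subgraph, not necessarily induced) is bicolored, i.e. has its vertices colored using only two colors. The $P_k$-chromatic number $s_k(G)$ is the minimum number of colors in a $P_k$-coloring of $G$. -}

module Defs where

open import Data.Fin.Base using (Fin; toℕ)
open import Data.Nat.Base using (ℕ; suc; _≤_)
open import Data.Nat.Properties using (1+n≢n)
open import Data.Product.Base using (_×_; _,_; Σ-syntax; ∃-syntax)
open import Data.Sum.Base using (_⊎_; inj₁; inj₂; swap)
open import Function.Definitions using (Injective)
open import Relation.Binary.Core using (Rel; _Preserves_⟶_)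
open import Relation.Binary.Definitions using (Irreflexive; Symmetric)
open import Relation.Binary.PropositionalEquality using (_≡_; _≢_; refl; sym)
open import Relation.Nullary.Negation using (¬_)
open import Level using (0ℓ)

record Graph : Set₁ where
  field
    Vertex    : Set
    Adj       : Rel Vertex 0ℓ
    symmetric : Symmetric Adj
    loopless  : Irreflexive _≡_ Adj

open Graph

Path : ℕ → Graph
Path n = record
  { Vertex    = Fin n
  ; Adj       = λ i j → (toℕ j ≡ suc (toℕ i)) ⊎ (toℕ i ≡ suc (toℕ j))
  ; symmetric = swap
  ; loopless  = λ where
      refl (inj₁ e) → 1+n≢n (sym e)
      refl (inj₂ e) → 1+n≢n (sym e)
  }

infixr 7 _□_

_□_ : Graph → Graph → Graph
G □ H = record
  { Vertex    = Vertex G × Vertex H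
  ; Adj       = λ { (u , v) (u′ , v′) →
                    (u ≡ u′ × Adj H v v′) ⊎ (Adj G u u′ × v ≡ v′) }
  ; symmetric = λ where
      (inj₁ (e , a)) → inj₁ (sym e , symmetric H a)
      (inj₂ (a , e)) → inj₂ (symmetric G a , sym e)
  ; loopless  = λ where
      refl (inj₁ (_ , a)) → loopless H refl a
      refl (inj₂ (a , _)) → loopless G refl a
  }

-- A copy of H in G as a subgraph.  Non-adjacency need not be preserved,
-- so the copy is not necessarily induced.
record Copy (H G : Graph) : Set where
  field
    embed     : Vertex H → Vertex G
    injective : Injective _≡_ _≡_ embed
    preserves : embed Preserves Adj H ⟶ Adj G

Coloring : Graph → ℕ → Set
Coloring G q = Vertex G → Fin q

Proper : (G : Graph) {q : ℕ} → Coloring G q → Set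
Proper G c = ∀ {u v} → Adj G u v → c u ≢ c v

Bicolored : {H G : Graph} {q : ℕ} → Coloring G q → Copy H G → Set
Bicolored c p = ∃[ a ] ∃[ b ] (∀ i → c (embed i) ≡ a ⊎ c (embed i) ≡ b)
  where open Copy p

record IsPathColoring (k : ℕ) (G : Graph) {q : ℕ} (c : Coloring G q) : Set where
  field
    proper       : Proper G c
    no-bicolored : (p : Copy (Path k) G) → ¬ Bicolored c p

PathColorable : (k : ℕ) (G : Graph) (q : ℕ) → Set
PathColorable k G q = Σ[ c ∈ Coloring G q ] IsPathColoring k G c

-- "sₖ(G) = s", stated as a relation because the minimum need not be
-- computable for an arbitrary Graph.
record IsPathChromaticNumber (k : ℕ) (G : Graph) (s : ℕ) : Set where
  field
    attained : PathColorable k G s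
    minimal  : ∀ q → PathColorable k G q → s ≤ q

{-# OPTIONS --safe #-}

-- Upper bound: colour (i , j) by ⌊ ((2i + 3j) mod 8) / 2 ⌋.  Crossing an edge
-- changes the residue by ±2 or ±3, so bicolored paths can be followed on residues
-- alone; every component of the subgraph induced by two colours turns out to have
-- at most four vertices, so not even a P₅ is bicolored.
--
-- Lower bound: a colouring of Pₙ □ Pₘ restricts to P₄ □ P₄, where a backtracking
-- search shows that every partial colouring with at most three colours runs into
-- a monochromatic edge or a bicolored P₆.
module Submission where

open import Defs
open import Data.Fin.Base using (Fin; zero; suc; toℕ; fromℕ<; inject≤; quotient)
open import Data.Fin.Patterns using (0F; 1F; 2F; 3F; 4F)
open import Data.Fin.Properties
  using (_≟_; all?; sequence; toℕ-injective; toℕ-fromℕ<; fromℕ<-cong; toℕ-inject≤; inject≤-injective)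
open import Data.List.Base using (List; []; _∷_; allFin; cartesianProduct)
open import Data.List.Membership.Propositional using (_∈_)
open import Data.List.Relation.Unary.All using (All; []; _∷_; lookup)
open import Data.List.Relation.Unary.Any using (here; there)
open import Data.Maybe.Base using (Maybe; just; nothing; _<∣>_; _>>=_; map; from-just)
open import Data.Maybe.Effectful using (applicative)
open import Data.Nat.Base using (ℕ; zero; suc; _+_; _*_; _%_; _≤_; _≥_)
open import Data.Nat.DivMod using (_mod_; %-distribˡ-+; m%n%n≡m%n; m%n<n)
open import Data.Nat.Properties using (suc-injective; +-suc; +-comm; _≤?_; ≰⇒>)
  renaming (_≟_ to _≟ℕ_)
open import Data.Nat.Tactic.RingSolver using (solve-∀)
open import Data.Product.Base using (_×_; _,_; proj₁; proj₂)
open import Data.Product.Properties using (≡-dec)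
open import Data.Sum.Base as Sum using (_⊎_; inj₁; inj₂)
open import Function.Base using (_∘_)
open import Relation.Binary.Definitions using (Decidable; DecidableEquality)
open import Relation.Binary.PropositionalEquality
  using (_≡_; _≢_; refl; sym; trans; cong; cong₂; subst; module ≡-Reasoning)
open import Relation.Nullary.Decidable
  using (dec⇒maybe; yes; no; from-yes; ¬?; _×-dec_; _⊎-dec_; _→-dec_)
open import Relation.Nullary.Negation using (¬_; contradiction)

open Graph

-- The coloring with four colors

-- Taking `Fin 4` lets `all?` and `_≟_` decide statements about directions by enumeration.
Direction : Set
Direction = Fin 4

pattern east  = 0F
pattern north = 1F
pattern west  = 2F
pattern south = 3F

opposite : Direction → Direction
opposite east  = west
opposite north = south
opposite west  = east
opposite south = north

-- 2, 3, −2 and −3 modulo 8.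
offset : Direction → ℕ
offset east  = 2
offset north = 3
offset west  = 6
offset south = 5

step : Direction → Fin 8 → Fin 8
step d s = (toℕ s + offset d) mod 8

hue : Fin 8 → Fin 4
hue = quotient 2

-- Decided by checking 8 residues against 4⁴ step sequences. The conditions against `opposite` are
-- the trace that distinctness of path vertices leaves on residues.
no-bicolored-walk : ∀ s d₁ d₂ d₃ d₄ →
  let s₁ = step d₁ s ; s₂ = step d₂ s₁ ; s₃ = step d₃ s₂ ; s₄ = step d₄ s₃ in
  d₂ ≢ opposite d₁ → hue s ≡ hue s₂ →
  d₃ ≢ opposite d₂ → hue s₁ ≡ hue s₃ →
  d₄ ≢ opposite d₃ → hue s₂ ≢ hue s₄
no-bicolored-walk = from-yes (all? λ s → all? λ d₁ → all? λ d₂ → all? λ d₃ → all? λ d₄ →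
  let s₁ = step d₁ s ; s₂ = step d₂ s₁ ; s₃ = step d₃ s₂ ; s₄ = step d₄ s₃ in
  ¬? (d₂ ≟ opposite d₁) →-dec hue s ≟ hue s₂ →-dec
  ¬? (d₃ ≟ opposite d₂) →-dec hue s₁ ≟ hue s₃ →-dec
  ¬? (d₄ ≟ opposite d₃) →-dec ¬? (hue s₂ ≟ hue s₄))

-- Phases of grid vertices are not literally iterated `step`s; keeping the residues as variables
-- tied by equations lets the equations of `phase-direction` be plugged in.
no-bicolored-trail : ∀ s₀ {s₁ s₂ s₃ s₄ d₁ d₂ d₃ d₄} →
  s₁ ≡ step d₁ s₀ → s₂ ≡ step d₂ s₁ → s₃ ≡ step d₃ s₂ → s₄ ≡ step d₄ s₃ →
  d₂ ≢ opposite d₁ → hue s₀ ≡ hue s₂ →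
  d₃ ≢ opposite d₂ → hue s₁ ≡ hue s₃ →
  d₄ ≢ opposite d₃ → hue s₂ ≢ hue s₄
no-bicolored-trail s refl refl refl refl = no-bicolored-walk s _ _ _ _

hue-step : ∀ d s → hue s ≢ hue (step d s)
hue-step = from-yes (all? λ d → all? λ s → ¬? (hue s ≟ hue (step d s)))

-- South and west steps are handled as north and east steps undone.
step-opposite : ∀ d s → step (opposite d) (step d s) ≡ s
step-opposite = from-yes (all? λ d → all? λ s → step (opposite d) (step d s) ≟ s)

-- Makes the next residue a function of the previous residue alone, so that the coordinates can be
-- forgotten.
mod-+ : ∀ k l → (k + l) mod 8 ≡ (toℕ (k mod 8) + l) mod 8
mod-+ k l = fromℕ<-cong _ _ eq (m%n<n (k + l) 8) (m%n<n (toℕ (k mod 8) + l) 8)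
  where
  open ≡-Reasoning
  eq : (k + l) % 8 ≡ (toℕ (k mod 8) + l) % 8
  eq = begin
    (k + l) % 8                 ≡⟨ %-distribˡ-+ k l 8 ⟩
    (k % 8 + l % 8) % 8         ≡⟨ cong (λ r → (r + l % 8) % 8) (m%n%n≡m%n k 8) ⟨
    (k % 8 % 8 + l % 8) % 8     ≡⟨ %-distribˡ-+ (k % 8) l 8 ⟨
    (k % 8 + l) % 8             ≡⟨ cong (λ r → (r + l) % 8) (toℕ-fromℕ< (m%n<n k 8)) ⟨
    (toℕ (k mod 8) + l) % 8     ∎

-- Lifting the computation on residues to vertices of the grid.

module _ {n m : ℕ} where

  private
    Grid : Graph
    Grid = Path n □ Path m

  phase : Vertex Grid → Fin 8
  phase (i , j) = (2 * toℕ i + 3 * toℕ j) mod 8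

  phase-east : ∀ {i i′ : Fin n} (j : Fin m) → toℕ i′ ≡ suc (toℕ i) →
               phase (i′ , j) ≡ step east (phase (i , j))
  phase-east {i} {i′} j e = begin
    (2 * toℕ i′ + 3 * toℕ j) mod 8       ≡⟨ cong (λ k → (2 * k + 3 * toℕ j) mod 8) e ⟩
    (2 * suc (toℕ i) + 3 * toℕ j) mod 8  ≡⟨ cong (_mod 8) (shift (toℕ i) (toℕ j)) ⟩
    (2 * toℕ i + 3 * toℕ j + 2) mod 8    ≡⟨ mod-+ (2 * toℕ i + 3 * toℕ j) 2 ⟩
    step east (phase (i , j))            ∎
    where
    open ≡-Reasoning
    shift : ∀ a b → 2 * suc a + 3 * b ≡ 2 * a + 3 * b + 2
    shift = solve-∀

  phase-north : ∀ (i : Fin n) {j j′ : Fin m} → toℕ j′ ≡ suc (toℕ j) →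
                phase (i , j′) ≡ step north (phase (i , j))
  phase-north i {j} {j′} e = begin
    (2 * toℕ i + 3 * toℕ j′) mod 8       ≡⟨ cong (λ k → (2 * toℕ i + 3 * k) mod 8) e ⟩
    (2 * toℕ i + 3 * suc (toℕ j)) mod 8  ≡⟨ cong (_mod 8) (shift (toℕ i) (toℕ j)) ⟩
    (2 * toℕ i + 3 * toℕ j + 3) mod 8    ≡⟨ mod-+ (2 * toℕ i + 3 * toℕ j) 3 ⟩
    step north (phase (i , j))           ∎
    where
    open ≡-Reasoning
    shift : ∀ a b → 2 * a + 3 * suc b ≡ 2 * a + 3 * b + 3
    shift = solve-∀

  direction : ∀ {u v} → Adj Grid u v → Direction
  direction (inj₁ (_ , inj₁ _)) = north
  direction (inj₁ (_ , inj₂ _)) = south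
  direction (inj₂ (inj₁ _ , _)) = east
  direction (inj₂ (inj₂ _ , _)) = west

  phase-direction : ∀ {u v} (a : Adj Grid u v) → phase v ≡ step (direction a) (phase u)
  phase-direction {i , _} (inj₁ (refl , inj₁ e)) = phase-north i e
  phase-direction {i , _} (inj₁ (refl , inj₂ e)) =
    trans (sym (step-opposite north _)) (cong (step south) (sym (phase-north i e)))
  phase-direction {_ , j} (inj₂ (inj₁ e , refl)) = phase-east j e
  phase-direction {_ , j} (inj₂ (inj₂ e , refl)) =
    trans (sym (step-opposite east _)) (cong (step west) (sym (phase-east j e)))

  -- Opposite steps move the same coordinate by one up and one down. The contrapositive supplies the
  -- conditions against `opposite` from distinct vertices two steps apart.
  backtrack : ∀ {u v w} (a : Adj Grid u v) (b : Adj Grid v w) →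
              direction b ≡ opposite (direction a) → u ≡ w
  backtrack (inj₁ (refl , inj₁ e)) (inj₁ (refl , inj₂ e′)) _ =
    cong (_ ,_) (toℕ-injective (suc-injective (trans (sym e) e′)))
  backtrack (inj₁ (refl , inj₂ e)) (inj₁ (refl , inj₁ e′)) _ =
    cong (_ ,_) (toℕ-injective (trans e (sym e′)))
  backtrack (inj₂ (inj₁ e , refl)) (inj₂ (inj₂ e′ , refl)) _ =
    cong (_, _) (toℕ-injective (suc-injective (trans (sym e) e′)))
  backtrack (inj₂ (inj₂ e , refl)) (inj₂ (inj₁ e′ , refl)) _ =
    cong (_, _) (toℕ-injective (trans e (sym e′)))
  -- In all remaining pairs the second direction is not opposite to the first, so the equation
  -- identifies distinct numerals of `Fin 4`.
  backtrack (inj₁ (_ , inj₁ _)) (inj₁ (_ , inj₁ _)) ()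
  backtrack (inj₁ (_ , inj₁ _)) (inj₂ (inj₁ _ , _)) ()
  backtrack (inj₁ (_ , inj₁ _)) (inj₂ (inj₂ _ , _)) ()
  backtrack (inj₁ (_ , inj₂ _)) (inj₁ (_ , inj₂ _)) ()
  backtrack (inj₁ (_ , inj₂ _)) (inj₂ (inj₁ _ , _)) ()
  backtrack (inj₁ (_ , inj₂ _)) (inj₂ (inj₂ _ , _)) ()
  backtrack (inj₂ (inj₁ _ , _)) (inj₁ (_ , inj₁ _)) ()
  backtrack (inj₂ (inj₁ _ , _)) (inj₁ (_ , inj₂ _)) ()
  backtrack (inj₂ (inj₁ _ , _)) (inj₂ (inj₁ _ , _)) ()
  backtrack (inj₂ (inj₂ _ , _)) (inj₁ (_ , inj₁ _)) ()
  backtrack (inj₂ (inj₂ _ , _)) (inj₁ (_ , inj₂ _)) ()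
  backtrack (inj₂ (inj₂ _ , _)) (inj₂ (inj₂ _ , _)) ()

  latticeColoring : Coloring Grid 4
  latticeColoring v = hue (phase v)

  latticeColoring-proper : Proper Grid latticeColoring
  latticeColoring-proper {u} a =
    subst (λ s → latticeColoring u ≢ hue s) (sym (phase-direction a)) (hue-step (direction a) (phase u))

  no-bicolored-P₅ : ∀ {v₀ v₁ v₂ v₃ v₄} →
    Adj Grid v₀ v₁ → Adj Grid v₁ v₂ → Adj Grid v₂ v₃ → Adj Grid v₃ v₄ →
    v₀ ≢ v₂ → latticeColoring v₀ ≡ latticeColoring v₂ →
    v₁ ≢ v₃ → latticeColoring v₁ ≡ latticeColoring v₃ →
    v₂ ≢ v₄ → latticeColoring v₂ ≢ latticeColoring v₄
  no-bicolored-P₅ {v₀} a₁ a₂ a₃ a₄ v₀≢v₂ c₀≡c₂ v₁≢v₃ c₁≡c₃ v₂≢v₄ =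
    no-bicolored-trail (phase v₀)
      (phase-direction a₁) (phase-direction a₂) (phase-direction a₃) (phase-direction a₄)
      (v₀≢v₂ ∘ backtrack a₁ a₂) c₀≡c₂
      (v₁≢v₃ ∘ backtrack a₂ a₃) c₁≡c₃
      (v₂≢v₄ ∘ backtrack a₃ a₄)

-- Whichever of the two colors `y` takes, both `x` and `z` are left with the other one.
alternate : {A : Set} {a b x y z : A} → x ≡ a ⊎ x ≡ b → y ≡ a ⊎ y ≡ b → z ≡ a ⊎ z ≡ b →
            x ≢ y → y ≢ z → x ≡ z
alternate (inj₁ refl) _           (inj₁ refl) _   _   = refl
alternate (inj₂ refl) _           (inj₂ refl) _   _   = refl
alternate (inj₁ refl) (inj₁ refl) (inj₂ refl) x≢y _   = contradiction refl x≢y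
alternate (inj₁ refl) (inj₂ refl) (inj₂ refl) _   y≢z = contradiction refl y≢z
alternate (inj₂ refl) (inj₁ refl) (inj₁ refl) _   y≢z = contradiction refl y≢z
alternate (inj₂ refl) (inj₂ refl) (inj₁ refl) x≢y _   = contradiction refl x≢y

-- The first five vertices of the path already yield the contradiction, whatever the value of `k`.
latticeColoring-isPathColoring : ∀ {n m} k → IsPathColoring (5 + k) (Path n □ Path m) latticeColoring
latticeColoring-isPathColoring {n} {m} k = record
  { proper       = latticeColoring-proper
  ; no-bicolored = λ { p (_ , _ , h) →
      let open Copy p
          apart : ∀ {i j} → i ≢ j → embed i ≢ embed j
          apart i≢j e = i≢j (injective e)
          same : ∀ {i j l} → Adj Grid (embed i) (embed j) → Adj Grid (embed j) (embed l) →
                 latticeColoring (embed i) ≡ latticeColoring (embed l)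
          same {i} {j} {l} a b = alternate (h i) (h j) (h l)
            (latticeColoring-proper a) (latticeColoring-proper b)
          a₁ = preserves {0F} {1F} (inj₁ refl)
          a₂ = preserves {1F} {2F} (inj₁ refl)
          a₃ = preserves {2F} {3F} (inj₁ refl)
          a₄ = preserves {3F} {4F} (inj₁ refl)
      in no-bicolored-P₅ a₁ a₂ a₃ a₄
           (apart λ ()) (same a₁ a₂) (apart λ ()) (same a₂ a₃) (apart λ ()) (same a₃ a₄) }
  }
  where
  Grid : Graph
  Grid = Path n □ Path m

-- Refuting colorings of P₄ □ P₄

_∘ᶜ_ : ∀ {F G H} → Copy G H → Copy F G → Copy F H
p ∘ᶜ q = record
  { embed     = P.embed ∘ Q.embed
  ; injective = Q.injective ∘ P.injective
  ; preserves = P.preserves ∘ Q.preserves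
  }
  where
  module P = Copy p
  module Q = Copy q

-- Pull the coloring back along the copy: a bicolored path in `G` composes to one in `H` with the
-- same colors.
PathColorable-subgraph : ∀ {k q G H} → Copy G H → PathColorable k H q → PathColorable k G q
PathColorable-subgraph p (c , ok) = c ∘ P.embed , record
  { proper       = OK.proper ∘ P.preserves
  ; no-bicolored = OK.no-bicolored ∘ (p ∘ᶜ_)
  }
  where
  module P = Copy p
  module OK = IsPathColoring ok

Path-mono : ∀ {m n} → m ≤ n → Copy (Path m) (Path n)
Path-mono {m} {n} m≤n = record
  { embed     = ι
  ; injective = inject≤-injective m≤n m≤n _ _
  ; preserves = Sum.map shift shift
  }
  where
  ι : Fin m → Fin n
  ι i = inject≤ i m≤n
  shift : ∀ {i j} → toℕ j ≡ suc (toℕ i) → toℕ (ι j) ≡ suc (toℕ (ι i))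
  shift {i} {j} e = trans (toℕ-inject≤ j m≤n) (trans e (cong suc (sym (toℕ-inject≤ i m≤n))))

□-mono : ∀ {G G′ H H′} → Copy G G′ → Copy H H′ → Copy (G □ H) (G′ □ H′)
□-mono p q = record
  { embed     = λ (u , v) → P.embed u , Q.embed v
  ; injective = λ e → cong₂ _,_ (P.injective (cong proj₁ e)) (Q.injective (cong proj₂ e))
  ; preserves = λ where
      (inj₁ (e , a)) → inj₁ (cong P.embed e , Q.preserves a)
      (inj₂ (a , e)) → inj₂ (P.preserves a , cong Q.embed e)
  }
  where
  module P = Copy p
  module Q = Copy q

-- Building copies of paths one vertex at a time.

module _ {G : Graph} where

  trivial : Vertex G → Copy (Path 1) G
  trivial v = record
    { embed     = λ _ → v
    ; injective = λ { {0F} {0F} _ → refl }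
    ; preserves = λ { {0F} {0F} (inj₁ ()) ; {0F} {0F} (inj₂ ()) }
    }

  cons : ∀ {k} v (p : Copy (Path (suc k)) G) → let open Copy p in
         Adj G v (embed 0F) → (∀ i → embed i ≢ v) → Copy (Path (2 + k)) G
  cons {k} v p a fresh = record
    { embed     = embed′
    ; injective = injective′
    ; preserves = preserves′
    }
    where
    open Copy p
    embed′ : Fin (2 + k) → Vertex G
    embed′ zero    = v
    embed′ (suc i) = embed i
    injective′ : ∀ {i j} → embed′ i ≡ embed′ j → i ≡ j
    injective′ {zero}  {zero}  _ = refl
    injective′ {zero}  {suc j} e = contradiction (sym e) (fresh j)
    injective′ {suc i} {zero}  e = contradiction e (fresh i)
    injective′ {suc i} {suc j} e = cong suc (injective e)
    preserves′ : ∀ {i j} → Adj (Path (2 + k)) i j → Adj G (embed′ i) (embed′ j)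
    preserves′ {zero}  {suc zero} _        = a
    preserves′ {suc zero} {zero}  _        = symmetric G a
    preserves′ {suc i} {suc j}    (inj₁ e) = preserves (inj₁ (suc-injective e))
    preserves′ {suc i} {suc j}    (inj₂ e) = preserves (inj₂ (suc-injective e))
    preserves′ {zero}  {zero}     (inj₁ ())
    preserves′ {zero}  {zero}     (inj₂ ())
    preserves′ {zero}  {suc (suc j)} (inj₁ ())
    preserves′ {zero}  {suc (suc j)} (inj₂ ())
    preserves′ {suc (suc i)} {zero} (inj₁ ())
    preserves′ {suc (suc i)} {zero} (inj₂ ())

-- The membership proof is passed on because a refutation must look up the color of the chosen entry
-- in `Extends`.
firstJust : {A B : Set} (xs : List A) → (∀ {x} → x ∈ xs → Maybe B) → Maybe B
firstJust []       f = nothing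
firstJust (x ∷ xs) f = f (here refl) <∣> firstJust xs (f ∘ there)

-- A backtracking search whose successes carry proofs; `nothing` asserts nothing.

module Search (G : Graph) (_≟ᵛ_ : DecidableEquality (Vertex G)) (adj? : Decidable (Adj G))
              (l q : ℕ) where

  Partial : Set
  Partial = List (Vertex G × Fin q)

  Extends : Coloring G q → Partial → Set
  Extends c Γ = All (λ (v , a) → c v ≡ a) Γ

  Refuted : Partial → Set
  Refuted Γ = (c : Coloring G q) → IsPathColoring (suc l) G c → ¬ Extends c Γ

  -- Depth-first growth of a path at its front through vertices recorded with color `a` or `b`; `r`
  -- counts the vertices still missing.
  extendBicolored : (Γ : Partial) (a b : Fin q) (r : ℕ) {j : ℕ} (p : Copy (Path (suc j)) G) →
    let open Copy p in
    r + suc j ≡ suc l → (∀ i → (embed i , a) ∈ Γ ⊎ (embed i , b) ∈ Γ) → Maybe (Refuted Γ)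
  -- Matching `refl` fixes the length at `suc l`, and `ext` turns recorded colors into values of
  -- `c`.
  extendBicolored Γ a b zero p refl h = just λ c ok ext →
    IsPathColoring.no-bicolored ok p (a , b , Sum.map (lookup ext) (lookup ext) ∘ h)
  extendBicolored Γ a b (suc r) {j} p e h = firstJust Γ λ {(w , d)} w∈Γ → do
    w~p   ← dec⇒maybe (adj? w (embed 0F))
    d∈ab  ← dec⇒maybe (d ≟ a ⊎-dec d ≟ b)
    fresh ← dec⇒maybe (all? λ i → ¬? (embed i ≟ᵛ w))
    extendBicolored Γ a b r (cons w p w~p fresh) (trans (+-suc r (suc j)) e)
      λ { zero    → Sum.map (λ { refl → w∈Γ }) (λ { refl → w∈Γ }) d∈ab
        ; (suc i) → h i }
    where open Copy p

  refuteEdge : ∀ v a (Γ : Partial) → Maybe (Refuted ((v , a) ∷ Γ))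
  refuteEdge v a Γ = firstJust Γ λ {(w , b)} w∈Γ → do
    v~w  ← dec⇒maybe (adj? v w)
    refl ← dec⇒maybe (a ≟ b)
    just λ { c ok (cv≡a ∷ ext) →
      IsPathColoring.proper ok v~w (trans cv≡a (sym (lookup ext w∈Γ))) }

  -- Growth starts from `v`, so `v` is an endpoint and `a` is one of the two colors; only the second
  -- color varies.
  refutePath : ∀ v a (Γ : Partial) → Maybe (Refuted ((v , a) ∷ Γ))
  refutePath v a Γ = firstJust (allFin q) λ {b} _ →
    extendBicolored ((v , a) ∷ Γ) a b l (trivial v) (+-comm l 1) (λ _ → inj₁ (here refl))

  refute : List (Vertex G) → (Γ : Partial) → Maybe (Refuted Γ)
  refute []       Γ = nothing
  -- `sequence` combines one refutation per color of `v` into a refutation for all of them, which is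
  -- then used at the actual color `c v`.
  refute (v ∷ vs) Γ = map (λ h c ok ext → h (c v) c ok (refl ∷ ext)) (sequence applicative λ a →
    refuteEdge v a Γ <∣> refutePath v a Γ <∣> refute vs ((v , a) ∷ Γ))

  uncolorable : List (Vertex G) → Maybe (¬ PathColorable (suc l) G q)
  uncolorable vs = map (λ h (c , ok) → h c ok []) (refute vs [])

Path-adj? : ∀ n → Decidable (Adj (Path n))
Path-adj? n i j = (toℕ j ≟ℕ suc (toℕ i)) ⊎-dec (toℕ i ≟ℕ suc (toℕ j))

Grid-adj? : ∀ n m → Decidable (Adj (Path n □ Path m))
Grid-adj? n m (i , j) (i′ , j′) =
  (i ≟ i′ ×-dec Path-adj? m j j′) ⊎-dec (Path-adj? n i i′ ×-dec j ≟ j′)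

-- Each number of colors is a separate clause because `from-just` typechecks only once the search
-- evaluates to `just`, which requires a concrete `q`.
P₄□P₄-uncolorable : (q : Fin 4) → ¬ PathColorable 6 (Path 4 □ Path 4) (toℕ q)
P₄□P₄-uncolorable = λ where
    0F → from-just (search 0)
    1F → from-just (search 1)
    2F → from-just (search 2)
    3F → from-just (search 3)
  where
  search : ∀ q → Maybe (¬ PathColorable 6 (Path 4 □ Path 4) q)
  search q = uncolorable (cartesianProduct centreFirst centreFirst)
    where
    -- The argument 5 stands for paths on `suc 5` vertices.
    open Search (Path 4 □ Path 4) (≡-dec _≟_ _≟_) (Grid-adj? 4 4) 5 q
    -- In this order, testing only paths that start at the newest vertex prunes every branch.
    centreFirst = 1F ∷ 2F ∷ 0F ∷ 3F ∷ []

corollary13 : (n m : ℕ) → n ≥ 4 → m ≥ 4 → IsPathChromaticNumber 6 (Path n □ Path m) 4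
corollary13 n m 4≤n 4≤m = record
  -- The argument 1 makes `5 + k` equal to 6.
  { attained = latticeColoring , latticeColoring-isPathColoring 1
  ; minimal  = atLeastFour
  }
  where
  atLeastFour : ∀ q → PathColorable 6 (Path n □ Path m) q → 4 ≤ q
  atLeastFour q colorable with 4 ≤? q
  ... | yes 4≤q = 4≤q
  ... | no  4≰q = contradiction
    -- Rewrite `q` as `toℕ` of an element of `Fin 4`, the form covered by the finite case split.
    (subst (PathColorable 6 (Path 4 □ Path 4)) (sym (toℕ-fromℕ< (≰⇒> 4≰q)))
      (PathColorable-subgraph (□-mono (Path-mono 4≤n) (Path-mono 4≤m)) colorable))
    (P₄□P₄-uncolorable (fromℕ< (≰⇒> 4≰q)))
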